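{- Let $n\ge1$ and let $w$ be a Kreweras word of length $3n$ with trip permutation $\sigma_w$. Then \[\mathrm{evac}(w)=(w_{\sigma_w(3n)},w_{\sigma_w(3n-1)},\dots,w_{\sigma_w(1)}).\]
   Context: A Kreweras word of length $3n$ is a word $w=(w_1,\dots,w_{3n})$ in letters $\mathsf A,\mathsf B,\mathsf C$ with exactly $n$ of each letter such that every prefix has at least as many $\mathsf A$'s as $\mathsf B$'s and at least as many $\mathsf A$'s as $\mathsf C$'s. For $1\le i\le 3n-1$ let $\tau_i(w)$ be the word obtained by swapping $w_i$ and $w_{i+1}$ if the result is a Kreweras word, and $\tau_i(w)=w$ otherwise. Evacuation is $\mathrm{evac}=(\tau_1)\circ(\tau_2\circ\tau_1)\circ\cdots\circ(\tau_{3n-1}\circ\cdots\circ\tau_2\circ\tau_1)$ (maps applied right to left). Trip permutation: for $\varepsilon\in\{\mathsf B,\mathsf C\}$ let $M^\varepsilon_w$ be the unique noncrossing perfect matching of $\{i:w_i\in\{\mathsf A,\varepsilon\}\}$ by arcs $(i,j)$, $i<j$, with $w_i=\mathsf A$, $w_j=\varepsilon$ (noncrossing: no arcs $(i,j),(k,l)$ with $i<k<j<l$). Arcs $(a,b),(c,d)$ of $M^{\mathsf B}_w\cup M^{\mathsf C}_w$ cross if $a\le c<b<d$. Draw $1,\dots,3n$ in order on a horizontal line and each arc as a curve in the upper half plane joining its endpoints so that two arcs meet iff they cross, exactly once (arcs $(a,b),(a,d)$ meet at the point $a$). For $i\in\{1,\dots,3n\}$, take a walk starting at $i$: if $w_i\neq\mathsf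 A$, start along the unique arc containing $i$; if $w_i=\mathsf A$, start along the arc $(i,i')$ containing $i$ with the smaller $i'$. Whenever the walk reaches the meeting point of crossing arcs $(a,b),(c,d)$ with $a\le c<b<d$, it continues towards $b$ if it came from the direction of $a$, towards $a$ if it came from $c$, towards $d$ if it came from $b$, and towards $c$ if it came from $d$. The walk stops when it reaches a point $j\in\{1,\dots,3n\}$ where these rules do not send it on (in particular, arriving at $a$ along $(a,b)$ from $b$, where $(a,b),(a,d)$ with $b<d$ are the arcs at $a$, it continues along $(a,d)$ towards $d$; arriving at $a$ from $d$ it stops). Set $\sigma_w(i)=j$. Then $\sigma_w$ is a permutation of $\{1,\dots,3n\}$. -}

module Defs where

open import Data.Nat using (ℕ; zero; suc; _+_; _*_; _∸_; _≤_; _<_)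
open import Data.Nat.Properties using (_≟_; _≤?_)
open import Data.Bool using (Bool; true; false; if_then_else_)
open import Data.Maybe using (Maybe; just; nothing)
open import Data.List using (List; []; _∷_; length; filter; inits; map; upTo; reverse)
open import Data.List.Relation.Unary.All using (All; all?)
open import Data.List.Membership.Propositional using (_∈_)
open import Data.Product using (Σ; ∃; _×_; _,_; proj₁; proj₂)
open import Data.Product.Relation.Binary.Pointwise.NonDependent using ()
open import Data.Sum using (_⊎_)
open import Relation.Nullary using (Dec; yes; no; ¬_; does)
open import Relation.Nullary.Decidable using (_×-dec_; _⊎-dec_)
open import Relation.Binary.PropositionalEquality using (_≡_; refl)

data Letter : Set where
  A B C : Letter

_≟L_ : (x y : Letter) → Dec (x ≡ y)
A ≟L A = yes refl
A ≟L B = no (λ ())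
A ≟L C = no (λ ())
B ≟L A = no (λ ())
B ≟L B = yes refl
B ≟L C = no (λ ())
C ≟L A = no (λ ())
C ≟L B = no (λ ())
C ≟L C = yes refl

Word : Set
Word = List Letter

count : Letter → Word → ℕ
count x w = length (filter (_≟L x) w)

-- 1-based lookup: at w i = just w_i for 1 ≤ i ≤ length w, nothing otherwise
at : Word → ℕ → Maybe Letter
at []       _             = nothing
at (x ∷ xs) zero          = nothing
at (x ∷ xs) (suc zero)    = just x
at (x ∷ xs) (suc (suc k)) = at xs (suc k)

PrefixOK : Word → Set
PrefixOK p = (count B p ≤ count A p) × (count C p ≤ count A p)

Kreweras : ℕ → Word → Set
Kreweras n w =
  (count A w ≡ n) × (count B w ≡ n) × (count C w ≡ n) × All PrefixOK (inits w)

kreweras? : (n : ℕ) (w : Word) → Dec (Kreweras n w)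
kreweras? n w =
  (count A w ≟ n) ×-dec ((count B w ≟ n) ×-dec ((count C w ≟ n) ×-dec
    all? (λ p → (count B p ≤? count A p) ×-dec (count C p ≤? count A p)) (inits w)))

swapAt : ℕ → Word → Word
swapAt (suc zero)    (x ∷ y ∷ r) = y ∷ x ∷ r
swapAt (suc (suc k)) (x ∷ r)     = x ∷ swapAt (suc k) r
swapAt _             w           = w

τ : ℕ → ℕ → Word → Word
τ n i w = if does (kreweras? n (swapAt i w)) then swapAt i w else w

block : ℕ → ℕ → Word → Word
block n zero    w = w
block n (suc k) w = τ n (suc k) (block n k w)

evacAux : ℕ → ℕ → Word → Word
evacAux n zero    w = w
evacAux n (suc m) w = evacAux n m (block n (suc m) w)

evac : ℕ → Word → Word
evac n w = evacAux n (3 * n ∸ 1) w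

Arc : Set
Arc = ℕ × ℕ

incidences : ℕ → List Arc → ℕ
incidences k M = length (filter (λ e → (k ≟ proj₁ e) ⊎-dec (k ≟ proj₂ e)) M)

NCMatching : Letter → Word → List Arc → Set
NCMatching ε w M =
  (∀ {i j} → (i , j) ∈ M → (i < j) × (at w i ≡ just A) × (at w j ≡ just ε)) ×
  (∀ k → (at w k ≡ just A) ⊎ (at w k ≡ just ε) → incidences k M ≡ 1) ×
  (∀ {i j k l} → (i , j) ∈ M → (k , l) ∈ M → ¬ ((i < k) × (k < j) × (j < l)))

module Trip (MB MC : List Arc) where

  IsArc : Arc → Set
  IsArc e = (e ∈ MB) ⊎ (e ∈ MC)

  Crossing : Arc → Arc → Set
  Crossing (a , b) (c , d) = IsArc (a , b) × IsArc (c , d) × (a ≤ c) × (c < b) × (b < d)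

  -- The meeting point of crossing arcs (a,b),(c,d) (a ≤ c < b < d) is
  -- recorded on (a,b) by the coordinate c and on (c,d) by the coordinate b;
  -- crossings along an arc occur (in every admissible drawing) in the
  -- order of these coordinates.
  MeetOn : Arc → ℕ → Set
  MeetOn X q = Σ Arc (λ Z → (Crossing X Z × (q ≡ proj₁ Z)) ⊎ (Crossing Z X × (q ≡ proj₂ Z)))

  data Dir : Set where
    right left : Dir

  -- Walk X dir p j : walking along arc X in direction dir, currently at
  -- coordinate p of X (strictly past all meeting points already handled),
  -- the walk stops at the point j.
  data Walk : Arc → Dir → ℕ → ℕ → Set where
    stopR : ∀ {X p} → (∀ q → MeetOn X q → q ≤ p) → Walk X right p (proj₂ X)
    stopL : ∀ {X p} → (∀ q → MeetOn X q → p ≤ q) → Walk X left p (proj₁ X)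
    straightR : ∀ {X Z p j} → Crossing X Z → p < proj₁ Z →
      (∀ q → MeetOn X q → p < q → proj₁ Z ≤ q) →
      Walk X right (proj₁ Z) j → Walk X right p j
    turnR : ∀ {X Z p j} → Crossing Z X → p < proj₂ Z →
      (∀ q → MeetOn X q → p < q → proj₂ Z ≤ q) →
      Walk Z left (proj₁ X) j → Walk X right p j
    turnL : ∀ {X Z p j} → Crossing X Z → proj₁ Z < p →
      (∀ q → MeetOn X q → q < p → q ≤ proj₁ Z) →
      Walk Z right (proj₂ X) j → Walk X left p j
    straightL : ∀ {X Z p j} → Crossing Z X → proj₂ Z < p →
      (∀ q → MeetOn X q → q < p → q ≤ proj₂ Z) →
      Walk X left (proj₂ Z) j → Walk X left p j

  TripTo : Word → ℕ → ℕ → Set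
  TripTo w i j =
    ((at w i ≡ just A) × Σ ℕ (λ b → IsArc (i , b) × (∀ b' → IsArc (i , b') → b ≤ b')
                                   × Walk (i , b) right i j))
    ⊎ ((¬ (at w i ≡ just A)) × Σ ℕ (λ x → IsArc (x , i) × Walk (x , i) left i j))

reversedTripWord : ℕ → Word → (ℕ → ℕ) → List (Maybe Letter)
reversedTripWord n w σ = map (λ k → at w (σ k)) (reverse (map suc (upTo (3 * n))))

{-# OPTIONS --safe #-}
module Submission where

-- Read w from left to right, keeping the A's with an open arc on a stack.  A
-- trip moving right along an arc either reaches its end, or is deflected at a
-- crossing to the next open arc below, or, if there is none, turns left along
-- the closing arc; from then on it never turns again and stops at an A.  So
-- σ_w is computed by letting each trip sit on a stack entry: a letter B or C
-- shifts the trips it crosses down by one entry and emits the one it closes,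
-- and w_{σ_w(i)} is the letter emitting i, or A if i is never emitted.
--
-- Evacuation repeats the promotion step: delete the initial A, replace by A the
-- first letter at which its count catches up with that of the A's, and output
-- the replaced letter (or A if there is none).  That letter is the one emitting
-- the trip of the deleted A, and the stacks of the words before and after the
-- step remain so similar that all the other emissions agree.  By induction the
-- i-th output is the letter emitting i.

open import Defs
open import Data.Nat using (ℕ; zero; suc; _+_; _*_; _∸_; _≤_; _<_; z≤n; s≤s)
open import Data.Nat.Properties
open import Data.Bool using (if_then_else_)
open import Data.Empty using (⊥; ⊥-elim)
open import Data.Maybe using (Maybe; just; nothing)
open import Data.Maybe.Properties using (just-injective; ≡-dec)
open import Data.List
  using (List; []; _∷_; _++_; _∷ʳ_; [_]; length; map; filter; inits; reverse; upTo; applyUpTo)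
open import Data.List.Properties
  using (length-++; ++-assoc; ++-identityʳ; unfold-reverse; reverse-map; map-upTo; map-∘)
open import Data.List.Relation.Unary.All using (All; []; _∷_)
import Data.List.Relation.Unary.All as All
import Data.List.Relation.Unary.All.Properties as All
open import Data.List.Relation.Unary.Any using (here; there)
open import Data.List.Membership.Propositional using (_∈_)
open import Data.List.Membership.Propositional.Properties
  using (∈-filter⁺; ∈-filter⁻; ∈-++⁺ˡ; ∈-++⁺ʳ; ∈-++⁻)
open import Data.List.Relation.Binary.Permutation.Propositional
  using (_↭_; ↭-refl; ↭-sym; ↭-trans; prep; swap)
open import Data.List.Relation.Binary.Permutation.Propositional.Properties
  using (shift; ++⁺ˡ; filter-↭; ↭-length; ∈-resp-↭)
open import Data.Product using (Σ; ∃; ∃₂; _×_; _,_; proj₁; proj₂)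
open import Data.Sum using (_⊎_; inj₁; inj₂)
open import Function using (id; _∘_)
open import Relation.Nullary using (Dec; ¬_; yes; no; does)
open import Relation.Nullary.Decidable using (dec-true; dec-false)
open import Relation.Unary using (Decidable)
open import Relation.Binary.Definitions using (tri<; tri≈; tri>)
open import Relation.Binary.PropositionalEquality
  using (_≡_; _≢_; refl; sym; trans; cong; cong₂; subst; module ≡-Reasoning)

-- The two colors of arcs

data Color : Set where
  β γ : Color

letter : Color → Letter
letter β = B
letter γ = C

data Opposite : Color → Color → Set where
  βγ : Opposite β γ
  γβ : Opposite γ β

opposite : ∀ κ → ∃ (Opposite κ)
opposite β = γ , βγ
opposite γ = β , γβ

opposite-irrefl : ∀ {κ} → ¬ Opposite κ κ
opposite-irrefl ()

-- The stack machine

-- A stack entry stands for an A already read, the most recent one on top: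
-- it records which of its two arcs are still open, and the trip that is
-- currently moving right along the entry.
data Status : Set where
  both : Status
  only : Color → Status

Stack : Set
Stack = List (Status × ℕ)

-- Close κ x S e S': the letter κ closes the topmost κ-arc of S, crossing the
-- open arcs above it.  At each crossing the trip arriving on the crossed arc
-- turns into the next one below, so the trips shift down by one entry: the
-- trip x started at the letter enters on top, and the trip e of the closed
-- arc is emitted.  The trip dropped by pop turns left and ends at the opener.
data Close (κ : Color) : ℕ → Stack → ℕ → Stack → Set where
  halve : ∀ {λ' x e S} → Opposite κ λ' →
    Close κ x ((both , e) ∷ S) e ((only λ' , x) ∷ S)
  pop   : ∀ {x e S} → Close κ x ((only κ , e) ∷ S) e S
  pass  : ∀ {λ' x t e S S'} → Opposite κ λ' → Close κ t S e S' →
    Close κ x ((only λ' , t) ∷ S) e ((only λ' , x) ∷ S')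

-- p is the number of letters already read.
data Run : ℕ → Stack → Word → List (Color × ℕ) → Set where
  done  : ∀ {p S} → Run p S [] []
  push  : ∀ {p S v E} → Run (suc p) ((both , suc p) ∷ S) v E → Run p S (A ∷ v) E
  close : ∀ {p S e S' v E} κ → Close κ (suc p) S e S' → Run (suc p) S' v E →
    Run p S (letter κ ∷ v) ((κ , e) ∷ E)

-- Prefix heights

Height : Set
Height = ℕ × ℕ

height : Color → Height → ℕ
height β = proj₁
height γ = proj₂

up : Height → Height
up (b , c) = suc b , suc c

data Down : Color → Height → Height → Set where
  downβ : ∀ {b c} → Down β (suc b , c) (b , c)
  downγ : ∀ {b c} → Down γ (b , suc c) (b , c)

-- The prefix condition read from left to right, with `h` the excess of the A's over the B's and
-- over the C's so far. In this form it splits at any letter.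
data Ok : Height → Word → Set where
  []   : ∀ {h} → Ok h []
  okA  : ∀ {h v} → Ok (up h) v → Ok h (A ∷ v)
  okB  : ∀ {h h' v} → Down β h h' → Ok h' v → Ok h (B ∷ v)
  okC  : ∀ {h h' v} → Down γ h h' → Ok h' v → Ok h (C ∷ v)

okκ : ∀ {h h' v} κ → Down κ h h' → Ok h' v → Ok h (letter κ ∷ v)
okκ β = okB
okκ γ = okC

ok-A⁻ : ∀ {h v} → Ok h (A ∷ v) → Ok (up h) v
ok-A⁻ (okA o) = o

ok-κ⁻ : ∀ {h v} κ → Ok h (letter κ ∷ v) → ∃ λ h' → Down κ h h' × Ok h' v
ok-κ⁻ β (okB d o) = _ , d , o
ok-κ⁻ γ (okC d o) = _ , d , o

data Path : Height → Word → Height → Set where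
  []    : ∀ {h} → Path h [] h
  pathA : ∀ {h h' v} → Path (up h) v h' → Path h (A ∷ v) h'
  pathκ : ∀ {h h' h'' v} κ → Down κ h h' → Path h' v h'' → Path h (letter κ ∷ v) h''

heights : Stack → Height
heights [] = 0 , 0
heights ((both , _) ∷ S) = up (heights S)
heights ((only β , _) ∷ S) = suc (proj₁ (heights S)) , proj₂ (heights S)
heights ((only γ , _) ∷ S) = proj₁ (heights S) , suc (proj₂ (heights S))

close-down : ∀ {κ x S e S'} → Close κ x S e S' → Down κ (heights S) (heights S')
close-down (halve βγ) = downβ
close-down (halve γβ) = downγ
close-down {β} pop = downβ
close-down {γ} pop = downγ
close-down {S = (only γ , _) ∷ S} (pass βγ c) with heights S | close-down c
... | _ | downβ = downβ
close-down {S = (only β , _) ∷ S} (pass γβ c) with heights S | close-down c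
... | _ | downγ = downγ

down-functional : ∀ {κ h h₁ h₂} → Down κ h h₁ → Down κ h h₂ → h₁ ≡ h₂
down-functional downβ downβ = refl
down-functional downγ downγ = refl

positive⇒close : ∀ κ x S {m} → height κ (heights S) ≡ suc m → ∃₂ (Close κ x S)
positive⇒close β x ((both , e) ∷ S) _ = _ , _ , halve βγ
positive⇒close γ x ((both , e) ∷ S) _ = _ , _ , halve γβ
positive⇒close β x ((only β , e) ∷ S) _ = _ , _ , pop
positive⇒close γ x ((only γ , e) ∷ S) _ = _ , _ , pop
positive⇒close β x ((only γ , t) ∷ S) eq with positive⇒close β t S eq
... | _ , _ , c = _ , _ , pass βγ c
positive⇒close γ x ((only β , t) ∷ S) eq with positive⇒close γ t S eq
... | _ , _ , c = _ , _ , pass γβ c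

down-positive : ∀ {κ h h'} → Down κ h h' → height κ h ≡ suc (height κ h')
down-positive downβ = refl
down-positive downγ = refl

-- The numbers of open arcs on the stack change with the letters exactly as the excess does, so a
-- letter that `Ok` admits always finds an arc to close.
ok⇒run : ∀ {p v} S → Ok (heights S) v → ∃ (Run p S v)
ok⇒run S [] = _ , done
ok⇒run {p} S (okA o) with ok⇒run ((both , suc p) ∷ S) o
... | _ , r = _ , push r
ok⇒run {p} S (okB d o) with positive⇒close β (suc p) S (down-positive d)
... | _ , S' , c with ok⇒run S' (subst (λ h → Ok h _) (down-functional d (close-down c)) o)
... | _ , r = _ , close β c r
ok⇒run {p} S (okC d o) with positive⇒close γ (suc p) S (down-positive d)
... | _ , S' , c with ok⇒run S' (subst (λ h → Ok h _) (down-functional d (close-down c)) o)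
... | _ , r = _ , close γ c r

-- One promotion step

-- Promo h v v' o: deleting the initial A of A ∷ v (where h is the excess of
-- A's over B's and C's in the letters between it and v) and sliding leaves v'
-- and pushes the letter o out at the end.
data Promo : Height → Word → Word → Letter → Set where
  end   : ∀ {h} → Promo h [] [] A
  moveA : ∀ {h v v' o} → Promo (up h) v v' o → Promo h (A ∷ v) (A ∷ v') o
  moveκ : ∀ {h h' v v' o} κ → Down κ h h' → Promo h' v v' o →
    Promo h (letter κ ∷ v) (letter κ ∷ v') o
  halt  : ∀ {h v} κ → height κ h ≡ 0 → Promo h (letter κ ∷ v) (A ∷ v) (letter κ)

emit : Letter → ℕ → List (Color × ℕ)
emit A _ = []
emit B p = [ β , p ]
emit C p = [ γ , p ]

emit-letter : ∀ κ p → emit (letter κ) p ≡ [ κ , p ]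
emit-letter β p = refl
emit-letter γ p = refl

data AllOnly (λ' : Color) : Stack → Set where
  []  : AllOnly λ' []
  _∷_ : ∀ t {S} → AllOnly λ' S → AllOnly λ' ((only λ' , t) ∷ S)

no-close : ∀ {κ λ' S x e S'} → Opposite κ λ' → AllOnly λ' S → ¬ Close κ x S e S'
no-close o (_ ∷ a) pop = opposite-irrefl o
no-close o (_ ∷ a) (pass _ c) = no-close o a c

-- The stacks of the words before and after a promotion step that replaces a
-- letter κ by A, from that letter on: below the entries they share, only arcs
-- of the other color λ' are open.  The new A, with both arcs open, takes the
-- place of an old entry with an open λ'-arc until that arc closes; from then on
-- it is an additional entry whose κ-arc never closes.
data Blocked : Stack → Stack → Set where
  above   : ∀ {S S'} s → Blocked S S' → Blocked (s ∷ S) (s ∷ S')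
  twice   : ∀ {λ' x S} → AllOnly λ' S → Blocked ((only λ' , x) ∷ S) ((both , x) ∷ S)
  surplus : ∀ {κ λ' y S} → Opposite κ λ' → AllOnly λ' S → Blocked S ((only κ , y) ∷ S)

flip-opposite : ∀ {κ λ'} → Opposite κ λ' → Opposite λ' κ
flip-opposite βγ = γβ
flip-opposite γβ = βγ

same-or-opposite : ∀ κ λ' → κ ≡ λ' ⊎ Opposite κ λ'
same-or-opposite β β = inj₁ refl
same-or-opposite β γ = inj₂ βγ
same-or-opposite γ β = inj₂ γβ
same-or-opposite γ γ = inj₁ refl

opposite-functional : ∀ {κ λ' μ} → Opposite κ λ' → Opposite κ μ → λ' ≡ μ
opposite-functional βγ βγ = refl
opposite-functional γβ γβ = refl

-- A letter closing an arc of a shared entry acts alike on both stacks. Below these only a λ'-letter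
-- can close anything, and it emits the trip of the topmost old entry in both. The stacks may then
-- differ by the additional entry and in the trip dropped, but not in the trip emitted.
blocked-close : ∀ {κ S S' x e S₁} → Blocked S S' → Close κ x S e S₁ →
  ∃ λ S₁' → Close κ x S' e S₁' × Blocked S₁ S₁'
blocked-close (above _ b) (halve o) = _ , halve o , above _ b
blocked-close (above _ b) pop = _ , pop , b
blocked-close (above _ b) (pass o c) with blocked-close b c
... | _ , c' , b' = _ , pass o c' , above _ b'
blocked-close (twice {λ'} a) pop with opposite λ'
... | _ , o = _ , halve o , surplus (flip-opposite o) a
blocked-close (twice a) (pass o c) = ⊥-elim (no-close o a c)
blocked-close {μ} (surplus {κ} o a) c with same-or-opposite μ κ
... | inj₁ refl = ⊥-elim (no-close o a c)
blocked-close (surplus o (_ ∷ a)) pop | inj₂ o' = _ , pass o' pop , surplus o a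
blocked-close (surplus o (_ ∷ a)) (pass o'' c) | inj₂ o'
  with refl ← opposite-functional o' o'' = ⊥-elim (opposite-irrefl o)

blocked-run : ∀ {p S S' v E} → Blocked S S' → Run p S v E → Run p S' v E
blocked-run b done = done
blocked-run b (push r) = push (blocked-run (above _ b) r)
blocked-run b (close κ c r) with blocked-close b c
... | _ , c' , b' = close κ c' (blocked-run b' r)

-- If the letter closes an arc of the bottom entry, it crosses all of `T`. The entries left all have
-- the same status `only λ'`, so shifting the trips down amounts to putting one new entry on top.
close-above : ∀ {κ x t e S'} T → Close κ x (T ∷ʳ (both , t)) e S' →
  (∃ λ T' → Close κ x T e T' × S' ≡ T' ∷ʳ (both , t))
  ⊎ (∃ λ λ' → Opposite κ λ' × AllOnly λ' T × e ≡ t × S' ≡ (only λ' , x) ∷ T)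
close-above [] (halve o) = inj₂ (_ , o , [] , refl , refl)
close-above (_ ∷ T) (halve o) = inj₁ (_ , halve o , refl)
close-above (_ ∷ T) pop = inj₁ (_ , pop , refl)
close-above (_ ∷ T) (pass o c) with close-above T c
... | inj₁ (_ , c' , refl) = inj₁ (_ , pass o c' , refl)
... | inj₂ (_ , o' , a , refl , refl) with refl ← opposite-functional o o' =
  inj₂ (_ , o , _ ∷ a , refl , refl)

allOnly-height : ∀ {κ λ' S} → Opposite κ λ' → AllOnly λ' S → height κ (heights S) ≡ 0
allOnly-height βγ [] = refl
allOnly-height γβ [] = refl
allOnly-height βγ (_ ∷ a) = allOnly-height βγ a
allOnly-height γβ (_ ∷ a) = allOnly-height γβ a

-- Here `t` is the trip of the deleted A, at the bottom of the stack. The letter emitting `t` finds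
-- no arc of its color in `T`, and this is just where the slide halts. The emission of `t` is moved
-- to the front, hence the permutation.
run-promo : ∀ {p t v E} T → Run p (T ∷ʳ (both , t)) v E →
  ∃ λ v' → ∃ λ o → ∃ λ E' →
    Promo (heights T) v v' o × Run p T v' E' × E ↭ emit o t ++ E'
run-promo T done = _ , _ , _ , end , done , ↭-refl
run-promo T (push r) with run-promo ((both , _) ∷ T) r
... | _ , _ , _ , pr , r' , π = _ , _ , _ , moveA pr , push r' , π
run-promo {t = t} T (close κ c r) with close-above T c
... | inj₂ (_ , o , a , refl , refl) =
  -- Both words now have the trip of the current position on top of `T`: on an `only λ'` entry
  -- before the step, and on the `both` entry pushed by the new A after it.
  _ , _ , _ , halt κ (allOnly-height o a) , push (blocked-run (twice a) r) ,
  subst (λ es → (κ , t) ∷ _ ↭ es ++ _) (sym (emit-letter κ t)) ↭-refl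
... | inj₁ (T' , c' , refl) with run-promo T' r
... | v' , o , E' , pr , r' , π =
  _ , _ , _ , moveκ κ (close-down c') pr , close κ c' r' ,
  ↭-trans (prep _ π) (↭-sym (shift _ (emit o t) E'))

promo-length : ∀ {h v v' o} → Promo h v v' o → length v' ≡ length v
promo-length end = refl
promo-length (moveA p) = cong suc (promo-length p)
promo-length (moveκ κ _ p) = cong suc (promo-length p)
promo-length (halt κ _) = refl

-- The letter put out is not kept, so the word loses one letter in each step, as the blocks of
-- `evac` lose one transposition.
data Outs : Word → Word → Set where
  []  : Outs [] []
  _∷_ : ∀ {v v' o os} → Promo (0 , 0) v v' o → Outs v' os → Outs (A ∷ v) (o ∷ os)

emissions : ℕ → Word → List (Color × ℕ)
emissions p [] = []
emissions p (o ∷ os) = emit o (suc p) ++ emissions (suc p) os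

-- The shortened word is run from `suc p`, so the later letters keep their positions and the A
-- deleted next carries the trip from the next position.
run-outs : ∀ {p u E} m → length u ≡ m → Run p [] u E →
  ∃ λ os → Outs u os × E ↭ emissions p os
run-outs m _ done = [] , [] , ↭-refl
run-outs (suc m) eq (push r) with run-promo [] r
... | v' , o , _ , pr , r' , π
  with run-outs m (trans (promo-length pr) (suc-injective eq)) r'
... | os , outs , π' = o ∷ os , pr ∷ outs , ↭-trans π (++⁺ˡ (emit o _) π')
run-outs m _ (close κ () _)

-- Evacuation by promotion steps

count-swap : ∀ x (P : Word) {y z} (R : Word) → count x (P ++ y ∷ z ∷ R) ≡ count x (P ++ z ∷ y ∷ R)
count-swap x P R = ↭-length (filter-↭ (_≟L x) (++⁺ˡ P (swap _ _ ↭-refl)))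

HeightOK : Height → Word → Set
HeightOK (b , c) p = (count B p ≤ b + count A p) × (count C p ≤ c + count A p)

heightOK-A : ∀ h p → HeightOK h (A ∷ p) ≡ HeightOK (up h) p
heightOK-A (b , c) p = cong₂ (λ m n → (count B p ≤ m) × (count C p ≤ n))
  (+-suc b (count A p)) (+-suc c (count A p))

prefixes⇒ok : ∀ {h} v → All (HeightOK h) (inits v) → Ok h v
prefixes⇒ok [] _ = []
prefixes⇒ok {h} (A ∷ v) (_ ∷ all) =
  okA (prefixes⇒ok v (All.map (λ {p} → subst id (heightOK-A h p)) (All.map⁻ all)))
prefixes⇒ok {zero , c} (B ∷ v) (_ ∷ (() , _) ∷ _)
prefixes⇒ok {suc b , c} (B ∷ v) (_ ∷ all) =
  okκ β downβ (prefixes⇒ok v (All.map (λ { (s≤s p , q) → p , q }) (All.map⁻ all)))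
prefixes⇒ok {b , zero} (C ∷ v) (_ ∷ (_ , ()) ∷ _)
prefixes⇒ok {b , suc c} (C ∷ v) (_ ∷ all) =
  okκ γ downγ (prefixes⇒ok v (All.map (λ { (p , s≤s q) → p , q }) (All.map⁻ all)))

ok⇒prefixes : ∀ {h v} → Ok h v → All (HeightOK h) (inits v)
ok⇒prefixes [] = (z≤n , z≤n) ∷ []
ok⇒prefixes {h} (okA o) =
  (z≤n , z≤n) ∷ All.map⁺ (All.map (λ {p} → subst id (sym (heightOK-A h p))) (ok⇒prefixes o))
ok⇒prefixes (okB downβ o) =
  (z≤n , z≤n) ∷ All.map⁺ (All.map (λ (p , q) → s≤s p , q) (ok⇒prefixes o))
ok⇒prefixes (okC downγ o) =
  (z≤n , z≤n) ∷ All.map⁺ (All.map (λ (p , q) → p , s≤s q) (ok⇒prefixes o))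

kreweras⇒ok : ∀ {n} w → Kreweras n w → Ok (0 , 0) w
kreweras⇒ok w (_ , _ , _ , all) = prefixes⇒ok w all

path-ok⁻ : ∀ {h h' P R} → Path h P h' → Ok h (P ++ R) → Ok h' R
path-ok⁻ [] o = o
path-ok⁻ (pathA π) o = path-ok⁻ π (ok-A⁻ o)
path-ok⁻ (pathκ κ d π) o with _ , d' , o' ← ok-κ⁻ κ o
  with refl ← down-functional d d' = path-ok⁻ π o'

path-ok⁺ : ∀ {h h' P R} → Path h P h' → Ok h' R → Ok h (P ++ R)
path-ok⁺ [] o = o
path-ok⁺ (pathA π) o = okA (path-ok⁺ π o)
path-ok⁺ (pathκ κ d π) o = okκ κ d (path-ok⁺ π o)

path-∷ʳA : ∀ {h h' P} → Path h P h' → Path h (P ∷ʳ A) (up h')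
path-∷ʳA [] = pathA []
path-∷ʳA (pathA π) = pathA (path-∷ʳA π)
path-∷ʳA (pathκ κ d π) = pathκ κ d (path-∷ʳA π)

path-∷ʳκ : ∀ {h h' h'' P} κ → Path h P h' → Down κ h' h'' → Path h (P ∷ʳ letter κ) h''
path-∷ʳκ κ [] d = pathκ κ d []
path-∷ʳκ κ (pathA π) d = pathA (path-∷ʳκ κ π d)
path-∷ʳκ κ (pathκ μ d' π) d = pathκ μ d' (path-∷ʳκ κ π d)

swapAt-++ : ∀ P {x y R} → swapAt (suc (length P)) (P ++ x ∷ y ∷ R) ≡ P ++ y ∷ x ∷ R
swapAt-++ [] = refl
swapAt-++ (_ ∷ []) = refl
swapAt-++ (z ∷ P@(_ ∷ _)) = cong (z ∷_) (swapAt-++ P)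

-- A swap changes neither the counts nor the path to `h`, so only the part of the word after `P` has
-- to be checked.
kreweras-swap : ∀ {n h} P {x y R} → Path (0 , 0) P h →
  (Ok h (x ∷ y ∷ R) → Ok h (y ∷ x ∷ R)) →
  Kreweras n (P ++ x ∷ y ∷ R) → Kreweras n (P ++ y ∷ x ∷ R)
kreweras-swap P {R = R} π f k@(a , b , c , _) =
  trans (count-swap A P R) a , trans (count-swap B P R) b , trans (count-swap C P R) c ,
  ok⇒prefixes (path-ok⁺ π (f (path-ok⁻ π (kreweras⇒ok _ k))))

τ-moves : ∀ n P {x y R} → Kreweras n (P ++ y ∷ x ∷ R) →
  τ n (suc (length P)) (P ++ x ∷ y ∷ R) ≡ P ++ y ∷ x ∷ R
τ-moves n P {x} {y} {R} k
  rewrite swapAt-++ P {x} {y} {R} | dec-true (kreweras? n (P ++ y ∷ x ∷ R)) k = refl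

τ-stays : ∀ n P {x y R} → ¬ Kreweras n (P ++ y ∷ x ∷ R) →
  τ n (suc (length P)) (P ++ x ∷ y ∷ R) ≡ P ++ x ∷ y ∷ R
τ-stays n P {x} {y} {R} k
  rewrite swapAt-++ P {x} {y} {R} | dec-false (kreweras? n (P ++ y ∷ x ∷ R)) k = refl

-- τ_{k+m} ∘ ⋯ ∘ τ_{k+1}
sweep : ℕ → ℕ → ℕ → Word → Word
sweep n k zero    w = w
sweep n k (suc m) w = sweep n (suc k) m (τ n (suc k) w)

block-++ : ∀ n k m w → sweep n k m (block n k w) ≡ block n (m + k) w
block-++ n k zero w = refl
block-++ n k (suc m) w = trans (block-++ n (suc k) m w) (cong (λ j → block n j w) (+-suc m k))

block-sweep : ∀ n m w → block n m w ≡ sweep n 0 m w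
block-sweep n m w =
  sym (trans (block-++ n 0 m w) (cong (λ j → block n j w) (+-identityʳ m)))

down-commute : ∀ {κ μ h h₁ h₂} → Down κ h h₁ → Down μ h₁ h₂ →
  ∃ λ h₁' → Down μ h h₁' × Down κ h₁' h₂
down-commute downβ downβ = _ , downβ , downβ
down-commute downβ downγ = _ , downγ , downβ
down-commute downγ downβ = _ , downβ , downγ
down-commute downγ downγ = _ , downγ , downγ

down-up : ∀ {κ h h'} → Down κ h h' → Down κ (up h) (up h')
down-up downβ = downβ
down-up downγ = downγ

data View : Letter → Set where
  isA : View A
  isκ : ∀ κ → View (letter κ)

view : ∀ x → View x
view A = isA
view B = isκ β
view C = isκ γ

-- Reading κ never raises a height, so `x` can be read before it; and the heights after both letters
-- do not depend on their order.
ok-delay-κ : ∀ {h x R} κ → Ok h (letter κ ∷ x ∷ R) → Ok h (x ∷ letter κ ∷ R)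
ok-delay-κ {x = x} κ o with ok-κ⁻ κ o | view x
... | _ , d , o' | isA = okA (okκ κ (down-up d) (ok-A⁻ o'))
... | _ , d , o' | isκ μ with ok-κ⁻ μ o'
... | _ , d' , o'' with down-commute d d'
... | _ , d₁ , d₂ = okκ μ d₁ (okκ κ d₂ o'')

ok-delay-A : ∀ {h h' R} κ → Down κ h h' → Ok h (A ∷ letter κ ∷ R) → Ok h (letter κ ∷ A ∷ R)
ok-delay-A κ d (okA o) with _ , d' , o' ← ok-κ⁻ κ o
  with refl ← down-functional (down-up d) d' = okκ κ d (okA o')

path-extend : ∀ {h h' P x R} → Path h P h' → Ok h' (x ∷ R) → ∃ λ h'' → Path h (P ∷ʳ x) h''
path-extend π (okA _) = _ , path-∷ʳA π
path-extend π (okB d _) = _ , path-∷ʳκ β π d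
path-extend π (okC d _) = _ , path-∷ʳκ γ π d

length-∷ʳ : ∀ (P : Word) x → length (P ∷ʳ x) ≡ suc (length P)
length-∷ʳ P x = trans (length-++ P) (+-comm (length P) 1)

sweep-step : ∀ n P {x y R} m {w} →
  τ n (suc (length P)) w ≡ P ++ x ∷ y ∷ R →
  sweep n (length P) (suc m) w ≡ sweep n (length (P ∷ʳ x)) m ((P ∷ʳ x) ++ y ∷ R)
sweep-step n P {x} {y} {R} m eq = cong₂ (λ k w → sweep n k m w)
  (sym (length-∷ʳ P x)) (trans eq (sym (++-assoc P [ x ] (y ∷ R))))

reassoc : ∀ {n} P {x : Letter} {R} → Kreweras n (P ++ x ∷ R) → Kreweras n ((P ∷ʳ x) ++ R)
reassoc {n} P {x} {R} = subst (Kreweras n) (sym (++-assoc P [ x ] R))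

-- The carried B or C never gets stuck: by `ok-delay-κ` each swap gives a Kreweras word.
carry : ∀ n {h} P κ v z → Path (0 , 0) P h → Kreweras n (P ++ letter κ ∷ v ++ z) →
  sweep n (length P) (length v) (P ++ letter κ ∷ v ++ z) ≡ P ++ v ++ letter κ ∷ z
carry n P κ [] z π k = refl
carry n P κ (x ∷ v) z π k
  with k' ← kreweras-swap P π (ok-delay-κ κ) k
  with _ , π' ← path-extend π (path-ok⁻ π (kreweras⇒ok _ k')) =
  trans (sweep-step n P (length v) (τ-moves n P k'))
  (trans (carry n (P ∷ʳ x) κ v z π' (reassoc P k'))
         (++-assoc P [ x ] _))

-- The sweep moves the A to the right until a swap would violate the prefix condition. Then this A
-- stays, and the letter that blocked it is carried to the end instead. The letters of `z` lie
-- beyond the range of the sweep.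
slide : ∀ n {h v v' o} P z → Path (0 , 0) P h → Promo h v v' o → Kreweras n (P ++ A ∷ v ++ z) →
  sweep n (length P) (length v) (P ++ A ∷ v ++ z) ≡ P ++ v' ++ o ∷ z
slide n P z π end k = refl
slide n P z π (moveA {v = v} pr) k =
  trans (sweep-step n P (length v) (τ-moves n P k))
  (trans (slide n (P ∷ʳ A) z (path-∷ʳA π) pr (reassoc P k))
         (++-assoc P [ A ] _))
slide n P z π (moveκ {v = v} κ d pr) k
  with k' ← kreweras-swap P π (ok-delay-A κ d) k =
  trans (sweep-step n P (length v) (τ-moves n P k'))
  (trans (slide n (P ∷ʳ letter κ) z (path-∷ʳκ κ π d) pr (reassoc P k'))
         (++-assoc P [ letter κ ] _))
slide n P z π (halt {v = v} κ eq) k =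
  trans (sweep-step n P (length v) (τ-stays n P blocked))
  (trans (carry n (P ∷ʳ A) κ v z (path-∷ʳA π) (reassoc P k))
         (++-assoc P [ A ] _))
  where
  blocked : ¬ Kreweras n (P ++ letter κ ∷ A ∷ v ++ z)
  blocked k' with _ , d , _ ← ok-κ⁻ κ (path-ok⁻ π (kreweras⇒ok _ k'))
    with () ← trans (sym eq) (down-positive d)

if-does : ∀ {s w} {P : Word → Set} (d : Dec (P s)) → P w → P (if does d then s else w)
if-does (yes p) _ = p
if-does (no _)  p = p

block-kreweras : ∀ n k w → Kreweras n w → Kreweras n (block n k w)
block-kreweras n zero w kr = kr
block-kreweras n (suc k) w kr =
  if-does {P = Kreweras n} (kreweras? n (swapAt (suc k) (block n k w))) (block-kreweras n k w kr)

-- Each round has one transposition fewer than the one before, so it leaves alone the outputs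
-- collected in `z` and adds its own in front of them; hence the reversal. The last A is its own
-- output and needs no round.
evacAux-outs : ∀ n m u {os} z → length u ≡ suc m → Outs u os → Kreweras n (u ++ z) →
  evacAux n m (u ++ z) ≡ reverse os ++ z
evacAux-outs n zero (A ∷ []) z refl (end ∷ []) kr = refl
evacAux-outs n (suc m) (A ∷ v) z eq (_∷_ {v' = v'} {o} {os} pr outs) kr =
  begin
    evacAux n m (block n (suc m) (A ∷ v ++ z)) ≡⟨ cong (evacAux n m) step ⟩
    evacAux n m (v' ++ o ∷ z)  ≡⟨ evacAux-outs n m v' (o ∷ z) (trans (promo-length pr) eq') outs kr' ⟩
    reverse os ++ o ∷ z        ≡⟨ ++-assoc (reverse os) [ o ] z ⟨
    (reverse os ∷ʳ o) ++ z     ≡⟨ cong (_++ z) (unfold-reverse o os) ⟨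
    reverse (o ∷ os) ++ z      ∎
  where
  open ≡-Reasoning
  eq' = suc-injective eq
  step : block n (suc m) (A ∷ v ++ z) ≡ v' ++ o ∷ z
  step = trans (block-sweep n (suc m) (A ∷ v ++ z))
    (subst (λ k → sweep n 0 k (A ∷ v ++ z) ≡ v' ++ o ∷ z) eq' (slide n [] z [] pr kr))
  kr' : Kreweras n (v' ++ o ∷ z)
  kr' = subst (Kreweras n) step (block-kreweras n (suc m) _ kr)

-- Trips as runs of the stack machine

letter≢A : ∀ κ → letter κ ≢ A
letter≢A β ()
letter≢A γ ()

letter-injective : ∀ {κ μ} → letter κ ≡ letter μ → κ ≡ μ
letter-injective {β} {β} _ = refl
letter-injective {γ} {γ} _ = refl

-- Arcs at a given position

filter-exists : ∀ {P : Arc → Set} (P? : Decidable P) M → length (filter P? M) ≡ 1 →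
  ∃ λ e → e ∈ M × P e
filter-exists P? M one with filter P? M in eq
... | e ∷ [] = e , ∈-filter⁻ P? (subst (e ∈_) (sym eq) (here refl))

filter-unique : ∀ {P : Arc → Set} (P? : Decidable P) M → length (filter P? M) ≡ 1 →
  ∀ {e e'} → e ∈ M → P e → e' ∈ M → P e' → e ≡ e'
filter-unique P? M one e∈ pe e'∈ pe'
  with filter P? M | one | ∈-filter⁺ P? e∈ pe | ∈-filter⁺ P? e'∈ pe'
... | _ ∷ [] | _ | here refl | here refl = refl

module _ (w : Word) (MB MC : List Arc)
  (ncB : NCMatching B w MB) (ncC : NCMatching C w MC) where

  open Trip MB MC

  M : Color → List Arc
  M β = MB
  M γ = MC

  nc : ∀ κ → NCMatching (letter κ) w (M κ)
  nc β = ncB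
  nc γ = ncC

  isArc : ∀ κ {e} → e ∈ M κ → IsArc e
  isArc β = inj₁
  isArc γ = inj₂

  arcColor : ∀ {e} → IsArc e → ∃ λ κ → e ∈ M κ
  arcColor (inj₁ m) = β , m
  arcColor (inj₂ m) = γ , m

  arc-< : ∀ κ {a b} → (a , b) ∈ M κ → a < b
  arc-< κ m = proj₁ (proj₁ (nc κ) m)

  arc-opener : ∀ κ {a b} → (a , b) ∈ M κ → at w a ≡ just A
  arc-opener κ m = proj₁ (proj₂ (proj₁ (nc κ) m))

  arc-closer : ∀ κ {a b} → (a , b) ∈ M κ → at w b ≡ just (letter κ)
  arc-closer κ m = proj₂ (proj₂ (proj₁ (nc κ) m))

  noncrossing : ∀ κ {a b c d} → (a , b) ∈ M κ → (c , d) ∈ M κ → ¬ (a < c × c < b × b < d)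
  noncrossing κ = proj₂ (proj₂ (nc κ))

  A-not-closer : ∀ κ {a b} → (a , b) ∈ M κ → at w b ≢ just A
  A-not-closer κ m eq = letter≢A κ (just-injective (trans (sym (arc-closer κ m)) eq))

  arc-exists : ∀ κ k → (at w k ≡ just A) ⊎ (at w k ≡ just (letter κ)) →
    ∃ λ e → e ∈ M κ × (k ≡ proj₁ e ⊎ k ≡ proj₂ e)
  arc-exists κ k h = filter-exists _ (M κ) (proj₁ (proj₂ (nc κ)) k h)

  opens : ∀ κ {k} → at w k ≡ just A → ∃ λ b → (k , b) ∈ M κ
  opens κ {k} eq with arc-exists κ k (inj₁ eq)
  ... | _ , m , inj₁ refl = _ , m
  ... | _ , m , inj₂ refl = ⊥-elim (A-not-closer κ m eq)

  closes : ∀ κ {k} → at w k ≡ just (letter κ) → ∃ λ a → (a , k) ∈ M κ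
  closes κ {k} eq with arc-exists κ k (inj₂ eq)
  ... | _ , m , inj₁ refl = ⊥-elim (letter≢A κ (just-injective (trans (sym eq) (arc-opener κ m))))
  ... | _ , m , inj₂ refl = _ , m

  opener-unique : ∀ κ {k b b'} → (k , b) ∈ M κ → (k , b') ∈ M κ → b ≡ b'
  opener-unique κ {k} m m' = cong proj₂
    (filter-unique _ (M κ) (proj₁ (proj₂ (nc κ)) k (inj₁ (arc-opener κ m)))
      m (inj₁ refl) m' (inj₁ refl))

  closer-unique : ∀ κ {a a' k} → (a , k) ∈ M κ → (a' , k) ∈ M κ → a ≡ a'
  closer-unique κ {k = k} m m' = cong proj₁
    (filter-unique _ (M κ) (proj₁ (proj₂ (nc κ)) k (inj₂ (arc-closer κ m)))
      m (inj₂ refl) m' (inj₂ refl))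

  closer-color : ∀ {κ μ a a' k} → (a , k) ∈ M κ → (a' , k) ∈ M μ → κ ≡ μ
  closer-color {κ} {μ} m m' =
    letter-injective (just-injective (trans (sym (arc-closer κ m)) (arc-closer μ m')))

  -- Walks along a single arc

  weakenR : ∀ {X p j} → ¬ MeetOn X (suc p) → Walk X right (suc p) j → Walk X right p j
  weakenR {X} {p} ¬m = go
    where
    beyond : ∀ {q} → MeetOn X q → p < q → suc p < q
    beyond m lt = ≤∧≢⇒< lt λ { refl → ¬m m }
    go : ∀ {j} → Walk X right (suc p) j → Walk X right p j
    go (stopR h) = stopR λ q m → ≮⇒≥ λ lt → <⇒≱ (beyond m lt) (h q m)
    go (straightR cr lt h wk) = straightR cr (<-trans (n<1+n p) lt) (λ q m l → h q m (beyond m l)) wk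
    go (turnR cr lt h wk) = turnR cr (<-trans (n<1+n p) lt) (λ q m l → h q m (beyond m l)) wk

  weakenL : ∀ {X p j} → ¬ MeetOn X p → Walk X left p j → Walk X left (suc p) j
  weakenL {X} {p} ¬m = go
    where
    below : ∀ {q} → MeetOn X q → q < suc p → q < p
    below m (s≤s le) = ≤∧≢⇒< le λ { refl → ¬m m }
    go : ∀ {j} → Walk X left p j → Walk X left (suc p) j
    go (stopL h) = stopL λ q m → ≮⇒≥ λ lt → <⇒≱ (below m lt) (h q m)
    go (turnL cr lt h wk) = turnL cr (<-trans lt (n<1+n p)) (λ q m l → h q m (below m l)) wk
    go (straightL cr lt h wk) = straightL cr (<-trans lt (n<1+n p)) (λ q m l → h q m (below m l)) wk

  isA? : ∀ k → Dec (at w k ≡ just A)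
  isA? k = ≡-dec _≟L_ (at w k) (just A)

  -- By `later` no arc closing at `suc p` meets `(c , d)` there. An A at `suc p` is passed straight
  -- on if its arc of the other color closes after `d`; otherwise there is no meeting point, as arcs
  -- of one color do not cross.
  stepR : ∀ {κ c d p j} → (c , d) ∈ M κ → c ≤ p → suc p < d →
    (∀ μ a → (a , suc p) ∈ M μ → c < a) →
    Walk (c , d) right (suc p) j → Walk (c , d) right p j
  stepR {κ} {c} {d} {p} m c≤p p<d later wk with isA? (suc p)
  ... | no ¬A = weakenR
    (λ { (Z , inj₁ ((_ , az , _) , refl)) → ¬A (arc-opener _ (proj₂ (arcColor az)))
       ; (Z , inj₂ ((az , _ , a≤c , _) , refl)) →
           <⇒≱ (later _ _ (proj₂ (arcColor az))) a≤c }) wk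
  ... | yes wA with opposite κ
  ... | μ , op with opens μ wA
  ... | d₁ , m₁ with d <? d₁
  ... | yes d<d₁ =
    straightR (isArc κ m , isArc μ m₁ , m≤n⇒m≤1+n c≤p , p<d , d<d₁) ≤-refl (λ _ _ l → l) wk
  ... | no d≮d₁ = weakenR noMeet wk
    where
    noMeet : ¬ MeetOn (c , d) (suc p)
    noMeet (Z , inj₂ ((az , _) , refl)) = A-not-closer _ (proj₂ (arcColor az)) wA
    noMeet ((_ , z) , inj₁ ((_ , az , _ , _ , d<z) , refl)) with arcColor az
    ... | ν , mz with same-or-opposite κ ν
    ... | inj₁ refl = noncrossing κ m mz (s≤s c≤p , p<d , d<z)
    ... | inj₂ op' with refl ← opposite-functional op op' =
      d≮d₁ (subst (d <_) (opener-unique μ mz m₁) d<z)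

  -- No meeting point to the left of `r` is the opener of a crossing arc. All of them are closers,
  -- and a walk to the left goes straight through these.
  runLeft : ∀ {κ a q} → (a , q) ∈ M κ → ∀ r → r ≤ q →
    (∀ Z → Crossing (a , q) Z → r ≤ proj₁ Z) → Walk (a , q) left r a
  runLeft m zero _ _ = stopL λ _ _ → z≤n
  runLeft {κ} {a} {q} m (suc r) r<q h with runLeft m r (<⇒≤ r<q) (λ Z cr → <⇒≤ (h Z cr)) | at w r in eq
  ... | wk | just x with view x
  ... | isκ μ = meets
    where
    closed = closes μ eq
    a' = proj₁ closed
    m' = proj₂ closed
    meets : Walk (a , q) left (suc r) a
    meets with a' ≤? a | a <? r
    ... | yes a'≤a | yes a<r =
      straightL (isArc μ m' , isArc κ m , a'≤a , a<r , r<q) ≤-refl (λ _ _ → ≤-pred) wk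
    ... | no a'≰a | _ = weakenL
      (λ { (Z , inj₁ (cr , refl)) → 1+n≰n (h Z cr)
         ; (Z , inj₂ ((az , _ , le , _) , refl)) → a'≰a (same az le) }) wk
      where
      same : ∀ {z} → IsArc (z , r) → z ≤ a → a' ≤ a
      same az le with arcColor az
      ... | ν , mz with refl ← closer-color m' mz with refl ← closer-unique ν m' mz = le
    ... | _ | no a≮r = weakenL
      (λ { (Z , inj₁ (cr , refl)) → 1+n≰n (h Z cr)
         ; (Z , inj₂ ((_ , _ , _ , lt , _) , refl)) → a≮r lt }) wk
  runLeft {κ} {a} {q} m (suc r) r<q h | wk | just _ | isA = weakenL
      (λ { (Z , inj₁ (cr , refl)) → 1+n≰n (h Z cr)
         ; (Z , inj₂ ((az , _) , refl)) → A-not-closer _ (proj₂ (arcColor az)) eq }) wk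
  runLeft {κ} {a} {q} m (suc r) r<q h | wk | nothing = weakenL
      (λ { (Z , inj₁ (cr , refl)) → 1+n≰n (h Z cr)
         ; (Z , inj₂ ((az , _) , refl)) → absurd (trans (sym eq) (arc-closer _ (proj₂ (arcColor az)))) }) wk
    where
    absurd : ∀ {x : Letter} → nothing ≢ just x
    absurd ()

  Gap : ℕ → ℕ → ℕ → Set
  Gap c u p = ∀ κ x y → (x , y) ∈ M κ → c < x → x < u → y ≤ p

  -- By `Gap` the arcs opened between `c` and `u` close too early to cross `(a , suc p)`. An arc
  -- meeting it at a closer in that range would violate noncrossing with `(a , suc p)` or `(c , d)`,
  -- whichever has its color. So `c` is the next meeting point, where the walk turns.
  crossLeft : ∀ {κ λ' a p c d u j} → Opposite κ λ' → (a , suc p) ∈ M κ → (c , d) ∈ M λ' →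
    a ≤ c → c < u → u ≤ suc p → suc p < d → Gap c u p →
    Walk (c , d) right (suc p) j → Walk (a , suc p) left u j
  crossLeft {κ} {λ'} {a} {p} {c} {d} {u} op ma mc a≤c c<u u≤q q<d gap =
    turnL (isArc κ ma , isArc λ' mc , a≤c , ≤-trans c<u u≤q , q<d) c<u meets
    where
    meets : ∀ m → MeetOn (a , suc p) m → m < u → m ≤ c
    meets m (Z , inj₁ ((_ , az , _ , _ , q<z) , refl)) m<u = ≮⇒≥ λ c<m →
      <⇒≱ q<z (m≤n⇒m≤1+n (gap _ _ _ (proj₂ (arcColor az)) c<m m<u))
    meets m ((a' , _) , inj₂ ((az , _ , a'≤a , a<m , m<q) , refl)) m<u with arcColor az
    ... | ν , mz with same-or-opposite κ ν
    ... | inj₁ refl = ⊥-elim (noncrossing κ mz ma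
            (≤∧≢⇒< a'≤a (λ { refl → <⇒≢ m<q (opener-unique κ mz ma) }) , a<m , m<q))
    ... | inj₂ op' with refl ← opposite-functional op op' = ≮⇒≥ λ c<m →
            noncrossing λ' mz mc
              (≤∧≢⇒< (≤-trans a'≤a a≤c) (λ { refl → <⇒≢ (<-trans m<q q<d) (opener-unique λ' mz mc) })
              , c<m , <-trans m<q q<d)

  -- The invariant relating stack entries to trips

  EndsAtOpener : ℕ → Set
  EndsAtOpener t = ∃ λ a → TripTo w t a × at w a ≡ just A

  -- After p letters, the trip from t moves right along the first arc opened
  -- at c to close after p.
  Valid : ℕ → ℕ → ℕ → Set
  Valid t c p = ∀ κ d → (c , d) ∈ M κ → p < d →
    (∀ μ d' → (c , d') ∈ M μ → p < d' → d ≤ d') →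
    ∀ j → Walk (c , d) right p j → TripTo w t j

  Shape : ℕ → Status → ℕ → Set
  Shape p both c = ∀ κ d → (c , d) ∈ M κ → p < d
  Shape p (only κ) c =
    (∀ d → (c , d) ∈ M κ → p < d) × (∀ μ d → Opposite μ κ → (c , d) ∈ M μ → d ≤ p)

  -- Good p u S: the entries of S are the openers before u of the arcs that
  -- close after p.
  data Good (p : ℕ) : ℕ → Stack → Set where
    nil  : ∀ {u} → (∀ κ x y → (x , y) ∈ M κ → x < u → y ≤ p) → Good p u []
    cons : ∀ {u st t c S} → c < u → at w c ≡ just A → Shape p st c → Valid t c p →
      Gap c u p → Good p c S → Good p u ((st , t) ∷ S)

  -- An arc closing at `suc p` meets `(c , d)` there only if it opens at or before `c`, which
  -- `later` excludes; so the trip stays on its entry.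
  valid-suc : ∀ {t c p} → c ≤ p → (∀ κ a → (a , suc p) ∈ M κ → c < a) →
    Valid t c p → Valid t c (suc p)
  valid-suc {c = c} {p} c≤p later val κ d m q<d short j wk =
    val κ d m (<-trans (n<1+n p) q<d) short' j (stepR m c≤p q<d later wk)
    where
    short' : ∀ μ d' → (c , d') ∈ M μ → p < d' → d ≤ d'
    short' μ d' m' p<d' with m≤n⇒m<n∨m≡n p<d'
    ... | inj₁ q<d' = short μ d' m' q<d'
    ... | inj₂ refl = ⊥-elim (<-irrefl refl (later μ c m'))

  shape-suc : ∀ {c p} st → (∀ κ a → (a , suc p) ∈ M κ → c < a) → Shape p st c → Shape (suc p) st c
  shape-suc both later sh κ d m =
    ≤∧≢⇒< (sh κ d m) λ { refl → <-irrefl refl (later _ _ m) }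
  shape-suc (only λ') later (open' , closed) =
    (λ d m → ≤∧≢⇒< (open' d m) λ { refl → <-irrefl refl (later _ _ m) }) ,
    (λ μ d op m → m≤n⇒m≤1+n (closed μ d op m))

  good-suc : ∀ {p u S} → u ≤ suc p → (∀ κ a → (a , suc p) ∈ M κ → u ≤ a) →
    Good p u S → Good (suc p) u S
  good-suc u≤q later (nil h) = nil λ κ x y m l → m≤n⇒m≤1+n (h κ x y m l)
  good-suc u≤q later (cons {st = st} c<u cA sh val gap g) =
    cons c<u cA (shape-suc st later' sh) (valid-suc (≤-pred (≤-trans c<u u≤q)) later' val)
      (λ κ x y m l l' → m≤n⇒m≤1+n (gap κ x y m l l'))
      (good-suc (<⇒≤ (≤-trans c<u u≤q)) (λ κ a m → <⇒≤ (later' κ a m)) g)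
    where
    later' = λ κ a m → ≤-trans c<u (later κ a m)

  good-push : ∀ {p S} → at w (suc p) ≡ just A → Good p (suc p) S →
    Good (suc p) (suc (suc p)) ((both , suc p) ∷ S)
  good-push {p} wA g = cons ≤-refl wA (λ κ d → arc-< κ) start
    (λ κ x y m l l' → ⊥-elim (<⇒≱ l (≤-pred l')))
    (good-suc ≤-refl (λ κ a m → ⊥-elim (A-not-closer κ m wA)) g)
    where
    start : Valid (suc p) (suc p) (suc p)
    -- The arc singled out by `Valid` is the one with the smaller closer, along which a trip from an
    -- A has to start.
    start κ d m _ short j wk = inj₁ (wA , d , isArc κ m , shortest , wk)
      where
      shortest : ∀ b' → IsArc (suc p , b') → d ≤ b'
      shortest b' ar with arcColor ar
      ... | μ , m' = short μ b' m' (arc-< μ m')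

  tokens : Stack → List ℕ
  tokens = map proj₂

  -- Once both arcs at `c` are closed, its entry can go: the gaps below and above `c` merge.
  widen : ∀ {p c u S} → c < u → (∀ κ d → (c , d) ∈ M κ → d ≤ p) → Gap c u p →
    Good p c S → Good p u S
  widen {p} {c} {u} c<u closed gap (nil h) = nil h'
    where
    h' : ∀ κ x y → (x , y) ∈ M κ → x < u → y ≤ p
    h' κ x y m x<u with <-cmp x c
    ... | tri< x<c _ _ = h κ x y m x<c
    ... | tri≈ _ refl _ = closed κ y m
    ... | tri> _ _ c<x = gap κ x y m c<x x<u
  widen {p} {c} {u} c<u closed gap (cons {c = c'} c'<c cA sh val gap' g) =
    cons (<-trans c'<c c<u) cA sh val gap'' g
    where
    gap'' : Gap c' u p
    gap'' κ x y m c'<x x<u with <-cmp x c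
    ... | tri< x<c _ _ = gap' κ x y m c'<x x<c
    ... | tri≈ _ refl _ = closed κ y m
    ... | tri> _ _ c<x = gap κ x y m c<x x<u

  module _ {κ a p} (m : (a , suc p) ∈ M κ) where

    private
      q = suc p

    -- The trip from `x` moves left along the closing arc and has come down to `u`; like `Valid`,
    -- this is phrased by how the trip may be continued.
    Enters : ℕ → ℕ → Set
    Enters x u = ∀ j → Walk (a , q) left u j → TripTo w x j

    opener-≤ : ∀ {c u} → Gap c u p → a < u → a ≤ c
    opener-≤ gap a<u = ≮⇒≥ λ c<a → 1+n≰n (gap κ a q m c<a a<u)

    -- `a` cannot lie in the gap above `c`, and if it lay below `c`, two arcs of color κ would cross
    -- or share a closer.
    opener-≡ : ∀ {c u d} → Gap c u p → a < u → c < u → u ≤ q →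
      (c , d) ∈ M κ → p < d → a ≡ c
    opener-≡ gap a<u c<u u≤q mc q≤d with m≤n⇒m<n∨m≡n (opener-≤ gap a<u) | m≤n⇒m<n∨m≡n q≤d
    ... | inj₂ eq  | _ = eq
    ... | inj₁ _   | inj₂ refl = closer-unique κ m mc
    ... | inj₁ a<c | inj₁ q<d = ⊥-elim (noncrossing κ m mc (a<c , ≤-trans c<u u≤q , q<d))

    emitted : ∀ {e} → Valid e a p → (∀ μ d → (a , d) ∈ M μ → p < d → q ≤ d) → TripTo w e q
    emitted val short = val κ q m ≤-refl short q (stopR λ
      { _ (Z , inj₁ ((_ , _ , _ , lt , _) , refl)) → ≤-pred lt
      ; _ (Z , inj₂ ((_ , _ , _ , _ , lt) , refl)) → ≤-pred lt })

    -- The other arc at `a` has closed already, so the walk to the left finds no opener to turn at,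
    -- not even `a` itself, and stops there.
    dropped : ∀ {x u} → u ≤ q → Gap a u p → (∀ μ d → Opposite κ μ → (a , d) ∈ M μ → d ≤ p) →
      Enters x u → EndsAtOpener x
    dropped {x} {u} u≤q gap closed ent = a , ent a (runLeft m u u≤q noCross) , arc-opener κ m
      where
      noCross : ∀ Z → Crossing (a , q) Z → u ≤ proj₁ Z
      noCross (c , d) (_ , az , a≤c , _ , q<d) with arcColor az
      ... | ν , mz with m≤n⇒m<n∨m≡n a≤c
      ... | inj₁ a<c = ≮⇒≥ λ c<u → <⇒≱ q<d (m≤n⇒m≤1+n (gap ν c d mz a<c c<u))
      ... | inj₂ refl with same-or-opposite κ ν
      ... | inj₁ refl = ⊥-elim (<⇒≢ q<d (opener-unique κ m mz))
      ... | inj₂ op = ⊥-elim (<⇒≱ q<d (m≤n⇒m≤1+n (closed ν d op mz)))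

    enters-valid : ∀ {λ' x c u} → Opposite κ λ' → a ≤ c → c < u → u ≤ q → Gap c u p →
      (∀ d → (c , d) ∈ M κ → d ≤ q) → Enters x u → Valid x c q
    enters-valid op a≤c c<u u≤q gap closed ent μ d mc q<d short j wk with same-or-opposite κ μ
    ... | inj₁ refl = ⊥-elim (<⇒≱ q<d (closed d mc))
    ... | inj₂ op' = ent j (crossLeft op' m mc a≤c c<u u≤q q<d gap wk)

    other-≢ : ∀ {μ c d} → Opposite κ μ → (c , d) ∈ M μ → q ≢ d
    other-≢ op mc refl with refl ← closer-color m mc = opposite-irrefl op

    -- Induction on `Close`: descending the stack follows the closing arc to the left, with `u` the
    -- last opener passed. The last component says that each trip is emitted, stays on the stack or
    -- is dropped.
    good-close : ∀ {x u S e S'} → Close κ x S e S' → Good p u S → a < u → u ≤ q → Enters x u →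
      Good q u S' × TripTo w e q ×
      (∀ i → i ∈ x ∷ tokens S → i ≡ e ⊎ i ∈ tokens S' ⊎ EndsAtOpener i)
    good-close {x} {u} (pop {e = e}) (cons {c = c} {S = S} c<u cA (open' , closed) val gap g) a<u u≤q ent
      with opens κ cA
    ... | d , mc with refl ← opener-≡ gap a<u c<u u≤q mc (open' d mc) =
      widen c<u allClosed (λ μ x y m l l' → m≤n⇒m≤1+n (gap μ x y m l l'))
        (good-suc (<⇒≤ (≤-trans c<u u≤q)) notBefore g) ,
      emitted val (λ _ _ _ l → l) , fate
      where
      notBefore : ∀ μ a' → (a' , q) ∈ M μ → a ≤ a'
      notBefore μ a' m' with refl ← closer-color m m' = ≤-reflexive (closer-unique κ m m')
      allClosed : ∀ μ d → (a , d) ∈ M μ → d ≤ q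
      allClosed μ d mc with same-or-opposite κ μ
      ... | inj₁ refl = ≤-reflexive (opener-unique κ mc m)
      ... | inj₂ op = m≤n⇒m≤1+n (closed μ d (flip-opposite op) mc)
      fate : ∀ i → i ∈ x ∷ e ∷ tokens S → i ≡ e ⊎ i ∈ tokens S ⊎ EndsAtOpener i
      fate i (here refl) = inj₂ (inj₂ (dropped u≤q gap
        (λ μ d op → closed μ d (flip-opposite op)) ent))
      fate i (there (here refl)) = inj₁ refl
      fate i (there (there i∈)) = inj₂ (inj₁ i∈)
    good-close {x} {u} (halve {λ'} {e = e} op) (cons {c = c} {S = S} c<u cA open' val gap g) a<u u≤q ent
      with opens κ cA
    ... | d , mc with refl ← opener-≡ gap a<u c<u u≤q mc (open' κ d mc) =
      cons c<u cA shape (enters-valid op ≤-refl c<u u≤q gap closed ent)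
        (λ μ x y m l l' → m≤n⇒m≤1+n (gap μ x y m l l'))
        (good-suc (<⇒≤ (≤-trans c<u u≤q)) notBefore g) ,
      emitted val (λ _ _ _ l → l) , fate
      where
      closed : ∀ d → (a , d) ∈ M κ → d ≤ q
      closed d mc = ≤-reflexive (opener-unique κ mc m)
      notBefore : ∀ μ a' → (a' , q) ∈ M μ → a ≤ a'
      notBefore μ a' m' with refl ← closer-color m m' = ≤-reflexive (closer-unique κ m m')
      shape : Shape q (only λ') a
      shape = (λ d mc → ≤∧≢⇒< (open' _ d mc) (other-≢ op mc)) , closed'
        where
        closed' : ∀ μ d → Opposite μ λ' → (a , d) ∈ M μ → d ≤ q
        closed' μ d op' mc with refl ← opposite-functional (flip-opposite op) (flip-opposite op') =
          closed d mc
      fate : ∀ i → i ∈ x ∷ e ∷ tokens S → i ≡ e ⊎ i ∈ x ∷ tokens S ⊎ EndsAtOpener i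
      fate i (here refl) = inj₂ (inj₁ (here refl))
      fate i (there (here refl)) = inj₁ refl
      fate i (there (there i∈)) = inj₂ (inj₁ (there i∈))
    good-close {x} {u} (pass {λ'} {t = t} {e} {S} {S'} op c')
      (cons {c = c} c<u cA (open' , closed) val gap g) a<u u≤q ent
      with m≤n⇒m<n∨m≡n (opener-≤ gap a<u)
    ... | inj₂ refl = ⊥-elim (1+n≰n (closed κ q op m))
    ... | inj₁ a<c with good-close c' g a<c (<⇒≤ (≤-trans c<u u≤q)) enters'
      where
      enters' : Enters t c
      enters' j wk with opens λ' cA
      -- The trip on the crossed arc turns left onto the closing arc at the crossing, and so becomes
      -- the trip entering the rest of the stack.
      ... | d , mc = val λ' d mc (open' d mc) short j
        (turnR (isArc κ m , isArc λ' mc , <⇒≤ a<c , ≤-trans c<u u≤q ,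
                ≤∧≢⇒< (open' d mc) (other-≢ op mc)) ≤-refl (λ _ _ l → l) wk)
        where
        short : ∀ μ d' → (c , d') ∈ M μ → p < d' → d ≤ d'
        short μ d' m' p<d' with same-or-opposite λ' μ
        ... | inj₁ refl = ≤-reflexive (opener-unique λ' mc m')
        ... | inj₂ op' = ⊥-elim (<⇒≱ p<d' (closed μ d' (flip-opposite op') m'))
    ... | g' , trip , fate' =
      cons c<u cA shape
        (enters-valid op (<⇒≤ a<c) c<u u≤q gap (λ d mc → m≤n⇒m≤1+n (closed κ d op mc)) ent)
        (λ μ x y m l l' → m≤n⇒m≤1+n (gap μ x y m l l')) g' ,
      trip , fate
      where
      shape : Shape q (only λ') c
      shape = (λ d mc → ≤∧≢⇒< (open' _ mc) (other-≢ op mc)) ,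
              (λ μ d op' mc → m≤n⇒m≤1+n (closed μ d op' mc))
      fate : ∀ i → i ∈ x ∷ t ∷ tokens S → i ≡ e ⊎ i ∈ x ∷ tokens S' ⊎ EndsAtOpener i
      fate i (here refl) = inj₂ (inj₁ (here refl))
      fate i (there i∈) with fate' i i∈
      ... | inj₁ eq = inj₁ eq
      ... | inj₂ (inj₁ i∈') = inj₂ (inj₁ (there i∈'))
      ... | inj₂ (inj₂ d) = inj₂ (inj₂ d)

  -- The trip from the letter itself starts to the left along the arc closing there, so the descent
  -- begins at `u = suc p` with this trip entering.
  good-read : ∀ {κ p S e S'} → at w (suc p) ≡ just (letter κ) → Close κ (suc p) S e S' →
    Good p (suc p) S →
    Good (suc p) (suc (suc p)) S' × TripTo w e (suc p) ×
    (∀ i → i ∈ suc p ∷ tokens S → i ≡ e ⊎ i ∈ tokens S' ⊎ EndsAtOpener i)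
  good-read {κ} {p} eq c g with closes κ eq
  ... | a , m with good-close m c g (arc-< κ m) ≤-refl
    (λ j wk → inj₂ ((λ wA → A-not-closer κ m wA) , a , isArc κ m , wk))
  ... | g' , trip , fate =
    widen ≤-refl (λ μ d mq → ⊥-elim (A-not-closer κ m (arc-opener μ mq)))
      (λ μ x y m l l' → ⊥-elim (<⇒≱ l (≤-pred l'))) g' , trip , fate

  -- Reading the whole word

  Suffix : ℕ → Word → Set
  Suffix p v = ∀ k → at v (suc k) ≡ at w (suc p + k)

  suffix-tail : ∀ {p x v} → Suffix p (x ∷ v) → Suffix (suc p) v
  suffix-tail {p} s k = trans (s (suc k)) (cong (at w) (+-suc (suc p) k))

  suffix-head : ∀ {p x v} → Suffix p (x ∷ v) → at w (suc p) ≡ just x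
  suffix-head {p} s = sym (trans (s 0) (cong (at w) (+-identityʳ (suc p))))

  suffix-end : ∀ {p k} → Suffix p [] → p < k → at w k ≡ nothing
  suffix-end {p} {k} s p<k =
    trans (cong (at w) (sym (m+[n∸m]≡n p<k))) (sym (s (k ∸ suc p)))

  good-end : ∀ {p u S} → Suffix p [] → Good p u S → S ≡ []
  good-end s (nil _) = refl
  good-end {p} s (cons {st = st} cA≤ cA sh _ _ _) = ⊥-elim (absurd st sh)
    where
    none : ∀ κ {a d} → (a , d) ∈ M κ → p < d → ⊥
    none κ m p<d with () ← trans (sym (suffix-end s p<d)) (arc-closer κ m)
    absurd : ∀ st → Shape p st _ → ⊥
    absurd both sh with opens β cA
    ... | d , m = none β m (sh β d m)
    absurd (only κ) (sh , _) with opens κ cA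
    ... | d , m = none κ m (sh d m)

  EndsAtCloser : Color → ℕ → Set
  EndsAtCloser κ t = ∃ λ k → TripTo w t k × at w k ≡ just (letter κ)

  emission⇒trip : ∀ {p S v E} → Run p S v E → Suffix p v → Good p (suc p) S →
    ∀ {κ i} → (κ , i) ∈ E → EndsAtCloser κ i
  emission⇒trip (push r) s g i∈ =
    emission⇒trip r (suffix-tail s) (good-push (suffix-head s) g) i∈
  emission⇒trip (close κ c r) s g i∈ with good-read (suffix-head s) c g | i∈
  ... | g' , trip , _ | here refl = _ , trip , suffix-head s
  ... | g' , _ , _ | there i∈' = emission⇒trip r (suffix-tail s) g' i∈'

  -- In the second alternative the trip has not been started yet.
  Pending : ℕ → Stack → Word → ℕ → Set
  Pending p S v i = i ∈ tokens S ⊎ p < i × i ≤ p + length v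

  -- No trip gets lost: one that is neither emitted nor dropped would remain on the stack, which is
  -- empty at the end by `good-end`.
  emitted-or-dropped : ∀ {p S v E} → Run p S v E → Suffix p v → Good p (suc p) S →
    ∀ {i} → Pending p S v i → (∃ λ κ → (κ , i) ∈ E) ⊎ EndsAtOpener i
  emitted-or-dropped {p} done s g pend with good-end s g | pend
  ... | refl | inj₂ (l , l') = ⊥-elim (<⇒≱ l (subst (_ ≤_) (+-identityʳ p) l'))
  emitted-or-dropped {p} (push {v = v} r) s g {i} pend =
    emitted-or-dropped r (suffix-tail s) (good-push (suffix-head s) g) (next pend)
    where
    next : Pending p _ (A ∷ v) i → Pending (suc p) ((both , suc p) ∷ _) v i
    next (inj₁ i∈) = inj₁ (there i∈)
    next (inj₂ (l , l')) with m≤n⇒m<n∨m≡n l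
    ... | inj₁ l'' = inj₂ (l'' , subst (i ≤_) (+-suc p _) l')
    ... | inj₂ refl = inj₁ (here refl)
  emitted-or-dropped {p} {S} (close {S' = S'} {v} {E} κ c r) s g {i} pend
    with good-read (suffix-head s) c g
  ... | g' , _ , fate = next pend
    where
    rec = emitted-or-dropped r (suffix-tail s) g' {i}
    later : (∃ λ μ → (μ , i) ∈ E) ⊎ EndsAtOpener i →
      (∃ λ μ → (μ , i) ∈ (κ , _) ∷ E) ⊎ EndsAtOpener i
    later (inj₁ (μ , i∈)) = inj₁ (μ , there i∈)
    later (inj₂ d) = inj₂ d
    entered : i ∈ suc p ∷ tokens S → (∃ λ μ → (μ , i) ∈ (κ , _) ∷ E) ⊎ EndsAtOpener i
    entered i∈ with fate i i∈
    ... | inj₁ refl = inj₁ (κ , here refl)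
    ... | inj₂ (inj₁ i∈') = later (rec (inj₁ i∈'))
    ... | inj₂ (inj₂ d) = inj₂ d
    next : Pending p S (letter κ ∷ v) i → (∃ λ μ → (μ , i) ∈ (κ , _) ∷ E) ⊎ EndsAtOpener i
    next (inj₁ i∈) = entered (there i∈)
    next (inj₂ (l , l')) with m≤n⇒m<n∨m≡n l
    ... | inj₁ l'' = later (rec (inj₂ (l'' , subst (i ≤_) (+-suc p _) l')))
    ... | inj₂ refl = entered (here refl)

-- The outputs as letters at the ends of trips

emission⁺ : ∀ {κ p} os k → at os (suc k) ≡ just (letter κ) → (κ , suc p + k) ∈ emissions p os
emission⁺ {κ} {p} (_ ∷ _) zero refl = ∈-++⁺ˡ (subst ((κ , suc p + 0) ∈_) (sym (emit-letter κ (suc p)))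
  (here (cong (κ ,_) (+-identityʳ (suc p)))))
emission⁺ {κ} {p} (o ∷ os) (suc k) eq = ∈-++⁺ʳ (emit o (suc p))
  (subst (λ i → (κ , i) ∈ emissions (suc p) os) (sym (+-suc (suc p) k)) (emission⁺ os k eq))

∈-emit⁻ : ∀ {κ i} o {p} → (κ , i) ∈ emit o p → i ≡ p × o ≡ letter κ
∈-emit⁻ B (here refl) = refl , refl
∈-emit⁻ C (here refl) = refl , refl

emission⁻ : ∀ {κ i p} os → (κ , i) ∈ emissions p os →
  ∃ λ k → i ≡ suc p + k × at os (suc k) ≡ just (letter κ)
emission⁻ {p = p} (o ∷ os) i∈ with ∈-++⁻ (emit o (suc p)) i∈
... | inj₁ i∈' with refl , refl ← ∈-emit⁻ o i∈' = 0 , sym (+-identityʳ (suc p)) , refl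
... | inj₂ i∈' with k , refl , eq ← emission⁻ os i∈' = suc k , sym (+-suc (suc p) k) , eq

outs-length : ∀ {u os} → Outs u os → length os ≡ length u
outs-length [] = refl
outs-length (pr ∷ outs) = cong suc (trans (outs-length outs) (promo-length pr))

length-count : ∀ w → length w ≡ count A w + (count B w + count C w)
length-count [] = refl
length-count (A ∷ w) = cong suc (length-count w)
length-count (B ∷ w) = trans (cong suc (length-count w)) (sym (+-suc (count A w) _))
length-count (C ∷ w) = trans (cong suc (length-count w))
  (trans (sym (+-suc (count A w) _)) (cong (count A w +_) (sym (+-suc (count B w) _))))

kreweras-length : ∀ n w → Kreweras n w → length w ≡ 3 * n
kreweras-length n w (a , b , c , _) rewrite length-count w | a | b | c =
  cong (λ m → n + (n + m)) (sym (+-identityʳ n))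

at-just : ∀ os k → k < length os → ∃ λ o → at os (suc k) ≡ just o
at-just (o ∷ os) zero _ = o , refl
at-just (o ∷ os) (suc k) (s≤s l) = at-just os k l

map-just-at : ∀ os (f : ℕ → Maybe Letter) → (∀ k → k < length os → at os (suc k) ≡ f k) →
  map just os ≡ applyUpTo f (length os)
map-just-at [] f h = refl
map-just-at (o ∷ os) f h =
  cong₂ _∷_ (h 0 (s≤s z≤n)) (map-just-at os (f ∘ suc) (λ k l → h (suc k) (s≤s l)))

evac-outs : ∀ {n} w {os} → 1 ≤ n → Kreweras n w → Outs w os → evac n w ≡ reverse os
-- With `n` a successor, `3 * n` reduces to the successor of `3 * n ∸ 1`, the length that
-- `evacAux-outs` asks for.
evac-outs {n@(suc _)} w {os} _ kr outs = begin
  evacAux n (3 * n ∸ 1) w         ≡⟨ cong (evacAux n (3 * n ∸ 1)) (++-identityʳ w) ⟨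
  evacAux n (3 * n ∸ 1) (w ++ []) ≡⟨ evacAux-outs n _ w [] (kreweras-length n w kr) outs
                                       (subst (Kreweras n) (sym (++-identityʳ w)) kr) ⟩
  reverse os ++ []                ≡⟨ ++-identityʳ (reverse os) ⟩
  reverse os                      ∎
  where open ≡-Reasoning

theorem4p12 : (n : ℕ) → 1 ≤ n → (w : Word) → Kreweras n w →
    (MB MC : List Arc) → NCMatching B w MB → NCMatching C w MC →
    Σ (ℕ → ℕ) (λ σ →
    (∀ i → 1 ≤ i → i ≤ 3 * n → Trip.TripTo MB MC w i (σ i)) ×
    (map just (evac n w) ≡ reversedTripWord n w σ))
theorem4p12 n 1≤n w kr MB MC ncB ncC
  with E , r ← ok⇒run {0} [] (kreweras⇒ok w kr)
  with os , outs , π ← run-outs (3 * n) (kreweras-length n w kr) r =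
  σ , (λ i l l' → proj₁ (proj₂ (choice i) l l')) , equation
  where
  open Trip MB MC using (TripTo)

  N : length os ≡ 3 * n
  N = trans (outs-length outs) (kreweras-length n w kr)

  start : Good w MB MC ncB ncC 0 1 []
  -- Positions count from 1, so no arc opens before 1.
  start = nil λ { κ zero y m _ → ⊥-elim (no-zero w (arc-opener w MB MC ncB ncC κ m))
                ; κ (suc _) y m (s≤s ()) }
    where
    no-zero : ∀ (v : Word) {x} → at v 0 ≢ just x
    no-zero [] ()
    no-zero (_ ∷ _) ()

  trip : ∀ k → suc k ≤ 3 * n → ∃ λ j → TripTo w (suc k) j × at w j ≡ at os (suc k)
  trip k l with at-just os k (subst (k <_) (sym N) l)
  ... | o , eq with view o
  ... | isκ κ with j , t , eq' ← emission⇒trip w MB MC ncB ncC r (λ _ → refl) start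
                     (∈-resp-↭ (↭-sym π) (emission⁺ os k eq)) =
    j , t , trans eq' (sym eq)
  -- An output A means that the trip from `suc k` occurs in no emission; so it is dropped and ends
  -- at an A.
  trip k l | _ , eq | isA with emitted-or-dropped w MB MC ncB ncC r (λ _ → refl) start
    (inj₂ (s≤s z≤n , subst (suc k ≤_) (sym (kreweras-length n w kr)) l))
  ... | inj₂ (j , t , eq') = j , t , trans eq' (sym eq)
  ... | inj₁ (κ , i∈) with k' , refl , eq' ← emission⁻ os (∈-resp-↭ π i∈) =
    ⊥-elim (letter≢A κ (just-injective (trans (sym eq') eq)))

  choice : ∀ i → ∃ λ j → 1 ≤ i → i ≤ 3 * n → TripTo w i j × at w j ≡ at os i
  -- Outside the range from 1 to `3 * n` the value 0 is a mere default.
  choice zero = 0 , λ ()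
  choice (suc k) with suc k ≤? 3 * n
  ... | yes l = proj₁ (trip k l) , λ _ _ → proj₂ (trip k l)
  ... | no ¬l = 0 , λ _ l → ⊥-elim (¬l l)

  σ : ℕ → ℕ
  σ i = proj₁ (choice i)

  equation : map just (evac n w) ≡ reversedTripWord n w σ
  equation = begin
    map just (evac n w)                     ≡⟨ cong (map just) (evac-outs w 1≤n kr outs) ⟩
    map just (reverse os)                   ≡⟨ reverse-map just os ⟩
    reverse (map just os)                   ≡⟨ cong reverse letters ⟩
    reverse (map atσ (map suc (upTo (3 * n)))) ≡⟨ reverse-map atσ (map suc (upTo (3 * n))) ⟨
    map atσ (reverse (map suc (upTo (3 * n)))) ∎
    where
    open ≡-Reasoning
    atσ = λ k → at w (σ k)
    letters : map just os ≡ map atσ (map suc (upTo (3 * n)))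
    letters = begin
      map just os                   ≡⟨ map-just-at os (atσ ∘ suc) (λ k l →
                                         sym (proj₂ (proj₂ (choice (suc k)) (s≤s z≤n) (subst (k <_) N l)))) ⟩
      applyUpTo (atσ ∘ suc) (length os) ≡⟨ cong (applyUpTo (atσ ∘ suc)) N ⟩
      applyUpTo (atσ ∘ suc) (3 * n) ≡⟨ map-upTo (atσ ∘ suc) (3 * n) ⟨
      map (atσ ∘ suc) (upTo (3 * n)) ≡⟨ map-∘ (upTo (3 * n)) ⟩
      map atσ (map suc (upTo (3 * n))) ∎
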